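{- Let $H(V,E)$ be the complete $r$-uniform hypergraph with $n$ vertices ($1\le r\le n$). Then its edge-domatic number satisfies $ed(H)=\binom{n}{r}$ if $r>\lfloor n/2\rfloor$, and $ed(H)=\binom{n}{r}\big/\tfrac{n}{r}$ if $r\le\lfloor n/2\rfloor$ and $r$ divides $n$.
   Context: A hypergraph $H(V,E)$ has a finite vertex set $V$ and a set $E$ of hyperedges, each a subset of $V$; it is $r$-uniform if every hyperedge has exactly $r$ vertices. The complete $r$-uniform hypergraph on $n$ vertices has as hyperedges all $r$-element subsets of $V$. Two distinct hyperedges are adjacent if they share at least one vertex. An edge-dominating set is a subset $E_d\subseteq E$ such that every hyperedge in $E\setminus E_d$ is adjacent to some hyperedge in $E_d$. The edge-domatic number $ed(H)$ is the maximum number of classes in a partition of $E$ into edge-dominating sets. -}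

module Defs where

open import Data.Nat using (ℕ; _≤_)
open import Data.Fin using (Fin)
open import Data.Fin.Subset using (Subset; ∣_∣; _∈_)
open import Data.Product using (Σ; ∃; _×_; proj₁)
open import Relation.Binary.PropositionalEquality using (_≡_; _≢_)

Edge : ℕ → ℕ → Set
Edge n r = Σ (Subset n) (λ s → ∣ s ∣ ≡ r)

Adjacent : ∀ {n r} → Edge n r → Edge n r → Set
Adjacent e f = ∃ λ v → (v ∈ proj₁ e) × (v ∈ proj₁ f)

-- A set of hyperedges, given by a predicate.
-- It is edge-dominating if every hyperedge not in it is adjacent to some
-- (necessarily distinct) hyperedge in it.
IsEdgeDominating : ∀ n r → (Edge n r → Set) → Set
IsEdgeDominating n r D =
  (e : Edge n r) → ¬D e → ∃ λ f → D f × Adjacent e f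
  where
  open import Relation.Nullary using (¬_)
  ¬D : Edge n r → Set
  ¬D x = ¬ (D x)

IsEdgeDomaticPartition : ∀ n r k → (Edge n r → Fin k) → Set
IsEdgeDomaticPartition n r k c =
  ((i : Fin k) → ∃ λ e → c e ≡ i) ×
  ((i : Fin k) → IsEdgeDominating n r (λ e → c e ≡ i))

HasEdgeDomaticPartition : ℕ → ℕ → ℕ → Set
HasEdgeDomaticPartition n r k =
  ∃ λ (c : Edge n r → Fin k) → IsEdgeDomaticPartition n r k c

IsEdgeDomaticNumber : ℕ → ℕ → ℕ → Set
IsEdgeDomaticNumber n r k =
  HasEdgeDomaticPartition n r k ×
  (∀ m → HasEdgeDomaticPartition n r m → m ≤ k)

{-# OPTIONS --safe #-}
module Submission where

-- If 2r > n any two hyperedges meet, so every nonempty set of hyperedges is dominating.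
-- If n = q r, a dominating class misses fewer than r vertices, hence has at least q hyperedges;
-- this gives the upper bound. The lower bound is Baranyai's theorem: the hyperedges split
-- into perfect matchings, each of which is dominating. As in the proof of Brouwer and
-- Schrijver, vertices are inserted one at a time into a family of partial partitions. Giving
-- the part S weight r − |S| makes the choice of the part that receives the next vertex a
-- fractional assignment with integral column sums, and such an assignment can be rounded to
-- an integral one.

open import Defs
open import Data.Nat using (ℕ; _≤_; _<_; _*_)
open import Data.Nat.DivMod using (_/_)
open import Data.Nat.Combinatorics using (_C_)
open import Data.Product using (_×_; ∃)
open import Relation.Binary.PropositionalEquality using (_≡_)

open import Data.Bool using (true; false; if_then_else_)
import Data.Bool.Properties as Bool
open import Data.Fin using (Fin; zero; suc; splitAt; _↑ˡ_; _↑ʳ_)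
import Data.Fin.Properties as Fin
open import Data.Fin.Subset.Properties using (_∈?_; drop-there)
open import Data.Fin.Subset using (Subset; inside; outside; ∣_∣; _∈_)
open import Data.List using (List; []; _∷_; map; _++_; allFin)
open import Data.List.Membership.Propositional using (lose) renaming (_∈_ to _∈ᴸ_; _∉_ to _∉ᴸ_)
import Data.List.Membership.DecPropositional as DecMembership
open import Data.List.Properties using (map-∘; map-tabulate; map-++)
open import Data.List.Relation.Unary.Any using (here; there; any?; satisfied)
open import Data.Nat.Combinatorics using (nCk≡nC[n∸k]; nCn≡1; k>n⇒nCk≡0; nCk+nC[k+1]≡[n+1]C[k+1])
open import Data.Nat.DivMod using (m*n/n≡m; /-monoˡ-≤)
open import Data.Nat using (zero; suc; pred; _+_; _∸_; s≤s; z≤n; NonZero; >-nonZero)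
open import Data.Nat.ListAction using (sum)
open import Data.Nat.ListAction.Properties using (sum-++)
open import Data.Nat.Properties hiding (_≟_)
import Data.Nat.Properties as ℕ
open import Data.Nat.Tactic.RingSolver using (solve-∀)
open import Data.Product using (_,_; proj₁; proj₂)
open import Data.Sum using (_⊎_; inj₁; inj₂)
open import Data.Vec using (Vec; []; _∷_)
import Data.Vec as Vec
open import Data.Vec.Base using (_[_]=_; here; there)
import Data.Vec.Properties as Vec
open import Function using (_∘_; id)
open import Relation.Binary using (DecidableEquality)
open import Relation.Binary.PropositionalEquality using (_≢_; refl; sym; trans; cong; cong₂; subst; module ≡-Reasoning)
open import Relation.Nullary using (¬_; Dec; yes; no; does; contradiction; ¬?; _×-dec_)
open import Relation.Nullary.Decidable using (map′; dec-true)

private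
  variable
    A B : Set
    P Q : Set

-- Indicators of decidable propositions and finite sums.

⟦_⟧ : Dec P → ℕ
⟦ d ⟧ = if does d then 1 else 0

⟦⟧-yes : (d : Dec P) → P → ⟦ d ⟧ ≡ 1
⟦⟧-yes (yes _) _ = refl
⟦⟧-yes (no ¬p) p = contradiction p ¬p

⟦⟧-no : (d : Dec P) → ¬ P → ⟦ d ⟧ ≡ 0
⟦⟧-no (yes p) ¬p = contradiction p ¬p
⟦⟧-no (no _) _ = refl

⟦⟧-witness : (d : Dec P) → 0 < ⟦ d ⟧ → P
⟦⟧-witness (yes p) _ = p

does⇒ : (d : Dec P) → does d ≡ true → P
does⇒ (yes p) _ = p

⟦⟧-mono : (d : Dec P) (e : Dec Q) → (P → Q) → ⟦ d ⟧ ≤ ⟦ e ⟧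
⟦⟧-mono (no _) e f = z≤n
⟦⟧-mono (yes p) e f = ≤-reflexive (sym (⟦⟧-yes e (f p)))

⟦⟧-cong : (d : Dec P) (e : Dec Q) → (P → Q) → (Q → P) → ⟦ d ⟧ ≡ ⟦ e ⟧
⟦⟧-cong d e f g = ≤-antisym (⟦⟧-mono d e f) (⟦⟧-mono e d g)

⟦⟧*-cong : (d : Dec P) {m n : ℕ} → (P → m ≡ n) → ⟦ d ⟧ * m ≡ ⟦ d ⟧ * n
⟦⟧*-cong (yes p) eq = cong (1 *_) (eq p)
⟦⟧*-cong (no _) eq = refl

∑ : List A → (A → ℕ) → ℕ
∑ xs f = sum (map f xs)

∑-cong : (xs : List A) {f g : A → ℕ} → (∀ x → f x ≡ g x) → ∑ xs f ≡ ∑ xs g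
∑-cong [] eq = refl
∑-cong (x ∷ xs) eq = cong₂ _+_ (eq x) (∑-cong xs eq)

∑-mono : (xs : List A) {f g : A → ℕ} → (∀ x → f x ≤ g x) → ∑ xs f ≤ ∑ xs g
∑-mono [] le = z≤n
∑-mono (x ∷ xs) le = +-mono-≤ (le x) (∑-mono xs le)

∑-0 : (xs : List A) → ∑ xs (λ _ → 0) ≡ 0
∑-0 [] = refl
∑-0 (x ∷ xs) = ∑-0 xs

∑-+ : (xs : List A) (f g : A → ℕ) → ∑ xs (λ x → f x + g x) ≡ ∑ xs f + ∑ xs g
∑-+ [] f g = refl
∑-+ (x ∷ xs) f g rewrite ∑-+ xs f g = interchange (f x) (g x) (∑ xs f) (∑ xs g)
  where
  interchange : ∀ a b c d → a + b + (c + d) ≡ a + c + (b + d)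
  interchange = solve-∀

∑-*ˡ : (xs : List A) (k : ℕ) (f : A → ℕ) → ∑ xs (λ x → k * f x) ≡ k * ∑ xs f
∑-*ˡ [] k f = sym (*-zeroʳ k)
∑-*ˡ (x ∷ xs) k f rewrite ∑-*ˡ xs k f = sym (*-distribˡ-+ k (f x) (∑ xs f))

∑-*ʳ : (xs : List A) (k : ℕ) (f : A → ℕ) → ∑ xs (λ x → f x * k) ≡ ∑ xs f * k
∑-*ʳ xs k f = trans (∑-cong xs λ x → *-comm (f x) k) (trans (∑-*ˡ xs k f) (*-comm k (∑ xs f)))

∑-swap : (xs : List A) (ys : List B) (f : A → B → ℕ) →
  ∑ xs (λ x → ∑ ys (f x)) ≡ ∑ ys (λ y → ∑ xs (λ x → f x y))
∑-swap [] ys f = sym (∑-0 ys)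
∑-swap (x ∷ xs) ys f rewrite ∑-swap xs ys f = sym (∑-+ ys (f x) (λ y → ∑ xs (λ x → f x y)))

∑-map : (h : A → B) (xs : List A) (f : B → ℕ) → ∑ (map h xs) f ≡ ∑ xs (f ∘ h)
∑-map h xs f = cong sum (sym (map-∘ xs))

∑-++ : (xs ys : List A) (f : A → ℕ) → ∑ (xs ++ ys) f ≡ ∑ xs f + ∑ ys f
∑-++ xs ys f = trans (cong sum (map-++ f xs ys)) (sum-++ (map f xs) (map f ys))

∑-term-≤ : {xs : List A} {x : A} (f : A → ℕ) → x ∈ᴸ xs → f x ≤ ∑ xs f
∑-term-≤ f (here refl) = m≤m+n _ _
∑-term-≤ f (there {x = y} x∈) = ≤-trans (∑-term-≤ f x∈) (m≤n+m _ (f y))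

∑-witness : (xs : List A) (f : A → ℕ) → 0 < ∑ xs f → ∃ λ x → x ∈ᴸ xs × 0 < f x
∑-witness (x ∷ xs) f pos with f x in eq
... | suc k = x , here refl , subst (0 <_) (sym eq) (s≤s z≤n)
... | zero with ∑-witness xs f pos
...   | y , y∈ , fy>0 = y , there y∈ , fy>0

-- Equal totals leave no slack in any single term. This turns a choice that respects all capacities
-- into an exact one.
∑-≡⇒≡ : (xs : List A) {f g : A → ℕ} → (∀ x → f x ≤ g x) → ∑ xs f ≡ ∑ xs g → ∀ {x} → x ∈ᴸ xs → f x ≡ g x
∑-≡⇒≡ (x ∷ xs) {f} {g} le eq x∈ = go x∈
  where
  fx≥gx : g x ≤ f x
  fx≥gx = +-cancelʳ-≤ (∑ xs f) (g x) (f x) (≤-trans (+-monoʳ-≤ (g x) (∑-mono xs le)) (≤-reflexive (sym eq)))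
  fx≡gx : f x ≡ g x
  fx≡gx = ≤-antisym (le x) fx≥gx
  go : ∀ {y} → y ∈ᴸ x ∷ xs → f y ≡ g y
  go (here refl) = fx≡gx
  go (there y∈) = ∑-≡⇒≡ xs le (+-cancelˡ-≡ (f x) _ _ (trans eq (cong (_+ ∑ xs g) (sym fx≡gx)))) y∈

-- Finite types and sums over all their elements.

record Finite (A : Set) : Set where
  field
    elems : List A
    _≟_   : DecidableEquality A
    -- Completeness and absence of repetitions in one equation between sums, so that it can be used
    -- directly inside double counting.
    once  : ∀ a → ∑ elems (λ x → ⟦ a ≟ x ⟧) ≡ 1

  ∈-elems : ∀ a → a ∈ᴸ elems
  ∈-elems a with ∑-witness elems (λ x → ⟦ a ≟ x ⟧) (≤-reflexive (sym (once a)))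
  ... | x , x∈ , pos = subst (_∈ᴸ elems) (sym (⟦⟧-witness (a ≟ x) pos)) x∈

  find? : {P : A → Set} → (∀ x → Dec (P x)) → Dec (∃ P)
  find? P? = map′ satisfied (λ (x , px) → lose (∈-elems x) px) (any? P? elems)

  ∑-sift : ∀ a (g : A → ℕ) → ∑ elems (λ x → ⟦ a ≟ x ⟧ * g x) ≡ g a
  ∑-sift a g = begin
    ∑ elems (λ x → ⟦ a ≟ x ⟧ * g x) ≡⟨ ∑-cong elems (λ x → ⟦⟧*-cong (a ≟ x) λ { refl → refl }) ⟩
    ∑ elems (λ x → ⟦ a ≟ x ⟧ * g a) ≡⟨ ∑-*ʳ elems (g a) (λ x → ⟦ a ≟ x ⟧) ⟩
    ∑ elems (λ x → ⟦ a ≟ x ⟧) * g a ≡⟨ cong (_* g a) (once a) ⟩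
    1 * g a                         ≡⟨ *-identityˡ (g a) ⟩
    g a                             ∎
    where open ≡-Reasoning

  -- Groups the terms by the value of `h`: each `g (h x)` is spread over `elems` by sifting, and the
  -- two sums are exchanged.
  ∑-fibres : (xs : List B) (h : B → A) (g : A → ℕ) →
    ∑ xs (g ∘ h) ≡ ∑ elems (λ a → ∑ xs (λ x → ⟦ h x ≟ a ⟧) * g a)
  ∑-fibres xs h g = begin
    ∑ xs (g ∘ h)                                        ≡⟨ ∑-cong xs (λ x → ∑-sift (h x) g) ⟨
    ∑ xs (λ x → ∑ elems (λ a → ⟦ h x ≟ a ⟧ * g a))      ≡⟨ ∑-swap xs elems _ ⟩
    ∑ elems (λ a → ∑ xs (λ x → ⟦ h x ≟ a ⟧ * g a))      ≡⟨ ∑-cong elems (λ a → ∑-*ʳ xs (g a) _) ⟩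
    ∑ elems (λ a → ∑ xs (λ x → ⟦ h x ≟ a ⟧) * g a)      ∎
    where open ≡-Reasoning

  -- The two sums differ only in their term at `a`; adding the other function's term on each side
  -- avoids subtraction.
  ∑-change-at : ∀ a (g h : A → ℕ) → (∀ x → x ≢ a → g x ≡ h x) → ∑ elems g + h a ≡ ∑ elems h + g a
  ∑-change-at a g h eq = begin
    ∑ elems g + h a                                ≡⟨ cong (∑ elems g +_) (∑-sift a h) ⟨
    ∑ elems g + ∑ elems (λ x → ⟦ a ≟ x ⟧ * h x)    ≡⟨ ∑-+ elems g _ ⟨
    ∑ elems (λ x → g x + ⟦ a ≟ x ⟧ * h x)          ≡⟨ ∑-cong elems pointwise ⟩
    ∑ elems (λ x → h x + ⟦ a ≟ x ⟧ * g x)          ≡⟨ ∑-+ elems h _ ⟩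
    ∑ elems h + ∑ elems (λ x → ⟦ a ≟ x ⟧ * g x)    ≡⟨ cong (∑ elems h +_) (∑-sift a g) ⟩
    ∑ elems h + g a                                ∎
    where
    open ≡-Reasoning
    pointwise : ∀ x → g x + ⟦ a ≟ x ⟧ * h x ≡ h x + ⟦ a ≟ x ⟧ * g x
    pointwise x with a ≟ x
    ... | yes refl = trans (cong (g x +_) (+-identityʳ (h x))) (trans (+-comm (g x) (h x)) (cong (h x +_) (sym (+-identityʳ (g x)))))
    ... | no a≢x = cong (_+ 0) (eq x (a≢x ∘ sym))

  ∑-two-terms-≤ : ∀ {a b} (g : A → ℕ) → a ≢ b → g a + g b ≤ ∑ elems g
  ∑-two-terms-≤ {a} {b} g a≢b = begin
    g a + g b                                                                    ≡⟨ cong₂ _+_ (∑-sift a g) (∑-sift b g) ⟨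
    ∑ elems (λ x → ⟦ a ≟ x ⟧ * g x) + ∑ elems (λ x → ⟦ b ≟ x ⟧ * g x)            ≡⟨ ∑-+ elems _ _ ⟨
    ∑ elems (λ x → ⟦ a ≟ x ⟧ * g x + ⟦ b ≟ x ⟧ * g x)                            ≤⟨ ∑-mono elems pointwise ⟩
    ∑ elems g                                                                    ∎
    where
    open ≤-Reasoning
    pointwise : ∀ x → ⟦ a ≟ x ⟧ * g x + ⟦ b ≟ x ⟧ * g x ≤ g x
    pointwise x with a ≟ x | b ≟ x
    ... | yes refl | yes refl = contradiction refl a≢b
    ... | yes refl | no _ = ≤-reflexive (trans (+-identityʳ _) (*-identityˡ (g x)))
    ... | no _ | yes refl = ≤-reflexive (*-identityˡ (g x))
    ... | no _ | no _ = z≤n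

open Finite using (elems; ∈-elems)

-- Enumerations of `Fin n` and of the subsets of an n-set.

∑-allFin-suc : ∀ {n} (f : Fin (suc n) → ℕ) → ∑ (allFin (suc n)) f ≡ f zero + ∑ (allFin n) (f ∘ suc)
∑-allFin-suc {n} f = cong (f zero +_) (trans (cong (λ xs → ∑ xs f) (sym (map-tabulate id suc))) (∑-map suc (allFin n) f))

∑-allFin-const : ∀ n k → ∑ (allFin n) (λ _ → k) ≡ n * k
∑-allFin-const zero k = refl
∑-allFin-const (suc n) k = trans (∑-allFin-suc {n} (λ _ → k)) (cong (k +_) (∑-allFin-const n k))

finiteFin : ∀ n → Finite (Fin n)
finiteFin n = record { elems = allFin n ; _≟_ = Fin._≟_ ; once = once }
  where
  once : ∀ {n} (a : Fin n) → ∑ (allFin n) (λ x → ⟦ a Fin.≟ x ⟧) ≡ 1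
  once {suc n} zero = trans (∑-allFin-suc {n} (λ x → ⟦ zero Fin.≟ x ⟧)) (cong suc (∑-0 (allFin n)))
  once {suc n} (suc a) = trans (∑-allFin-suc {n} (λ x → ⟦ suc a Fin.≟ x ⟧)) (trans (∑-cong (allFin n) λ x → ⟦⟧-cong (suc a Fin.≟ suc x) (a Fin.≟ x) (λ { refl → refl }) (cong suc)) (once a))

subsets : ∀ n → List (Subset n)
subsets zero = [] ∷ []
subsets (suc n) = map (inside ∷_) (subsets n) ++ map (outside ∷_) (subsets n)

_≟ˢ_ : ∀ {n} → DecidableEquality (Subset n)
_≟ˢ_ = Vec.≡-dec Bool._≟_

∑-subsets-suc : ∀ {n} (f : Subset (suc n) → ℕ) →
  ∑ (subsets (suc n)) f ≡ ∑ (subsets n) (f ∘ (inside ∷_)) + ∑ (subsets n) (f ∘ (outside ∷_))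
∑-subsets-suc {n} f = trans (∑-++ (map (inside ∷_) (subsets n)) _ f) (cong₂ _+_ (∑-map _ (subsets n) f) (∑-map _ (subsets n) f))

finiteSubset : ∀ n → Finite (Subset n)
finiteSubset n = record { elems = subsets n ; _≟_ = _≟ˢ_ ; once = once }
  where
  same : ∀ {n} b (S T : Subset n) → ⟦ (b ∷ S) ≟ˢ (b ∷ T) ⟧ ≡ ⟦ S ≟ˢ T ⟧
  same b S T = ⟦⟧-cong ((b ∷ S) ≟ˢ (b ∷ T)) (S ≟ˢ T) (λ { refl → refl }) (cong (b ∷_))
  once : ∀ {n} (S : Subset n) → ∑ (subsets n) (λ T → ⟦ S ≟ˢ T ⟧) ≡ 1
  once [] = refl
  once {suc n} (true ∷ S) = trans (∑-subsets-suc {n} (λ T → ⟦ (true ∷ S) ≟ˢ T ⟧)) (cong₂ _+_ (trans (∑-cong (subsets n) (same true S)) (once S)) (∑-0 (subsets n)))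
  once {suc n} (false ∷ S) = trans (∑-subsets-suc {n} (λ T → ⟦ (false ∷ S) ≟ˢ T ⟧)) (cong₂ _+_ (∑-0 (subsets n)) (trans (∑-cong (subsets n) (same false S)) (once S)))

-- Rounding: every row i ∈ R must choose one of its entries col i j so that each column c is
-- chosen exactly cap c times, given that weights proportional to these numbers exist.

module Rounding {R J K : Set} (FR : Finite R) (FJ : Finite J) (FK : Finite K) (col : R → J → K) where

  open Finite FK using (_≟_; ∑-fibres; once; find?)
  open DecMembership _≟_ using () renaming (_∈?_ to _∈ᴸ?_)

  Rs = elems FR
  Js = elems FJ
  Ks = elems FK

  load : (R → J) → K → ℕ
  load f c = ∑ Rs λ i → ⟦ col i (f i) ≟ c ⟧

  multiplicity : K → ℕ
  multiplicity c = ∑ Rs λ i → ∑ Js λ j → ⟦ col i j ≟ c ⟧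

  ∑-multiplicity : (g : K → ℕ) → ∑ Rs (λ i → ∑ Js (λ j → g (col i j))) ≡ ∑ Ks (λ c → multiplicity c * g c)
  ∑-multiplicity g = begin
    ∑ Rs (λ i → ∑ Js (λ j → g (col i j)))                           ≡⟨ ∑-cong Rs (λ i → ∑-fibres Js (col i) g) ⟩
    ∑ Rs (λ i → ∑ Ks (λ c → ∑ Js (λ j → ⟦ col i j ≟ c ⟧) * g c))    ≡⟨ ∑-swap Rs Ks _ ⟩
    ∑ Ks (λ c → ∑ Rs (λ i → ∑ Js (λ j → ⟦ col i j ≟ c ⟧) * g c))    ≡⟨ ∑-cong Ks (λ c → ∑-*ʳ Rs (g c) _) ⟩
    ∑ Ks (λ c → multiplicity c * g c)                               ∎
    where open ≡-Reasoning

  _[_≔_] : (R → J) → R → J → R → J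
  (f [ i ≔ j ]) k = if does (Finite._≟_ FR k i) then j else f k

  ≔-same : ∀ f i j → (f [ i ≔ j ]) i ≡ j
  ≔-same f i j with Finite._≟_ FR i i
  ... | yes _ = refl
  ... | no i≢i = contradiction refl i≢i

  ≔-other : ∀ f i j {k} → k ≢ i → (f [ i ≔ j ]) k ≡ f k
  ≔-other f i j {k} k≢i with Finite._≟_ FR k i
  ... | yes k≡i = contradiction k≡i k≢i
  ... | no _ = refl

  load-≔ : ∀ f i j c → load (f [ i ≔ j ]) c + ⟦ col i (f i) ≟ c ⟧ ≡ load f c + ⟦ col i j ≟ c ⟧
  load-≔ f i j c = trans
    (Finite.∑-change-at FR i _ _ (λ k k≢i → cong (λ x → ⟦ col k x ≟ c ⟧) (≔-other f i j k≢i)))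
    (cong (λ x → load f c + ⟦ col i x ≟ c ⟧) (≔-same f i j))

  -- The termination measure for the growth of the reachable set `Y` in `transfer-exists`.
  remaining : List K → ℕ
  remaining Y = ∑ Ks λ c → ⟦ ¬? (c ∈ᴸ? Y) ⟧

  remaining-∷ : ∀ Y y → y ∉ᴸ Y → remaining (y ∷ Y) < remaining Y
  remaining-∷ Y y y∉ = begin
    suc (remaining (y ∷ Y))                                ≡⟨ +-comm 1 _ ⟩
    remaining (y ∷ Y) + 1                                  ≡⟨ cong (remaining (y ∷ Y) +_) (once y) ⟨
    remaining (y ∷ Y) + ∑ Ks (λ c → ⟦ y ≟ c ⟧)             ≡⟨ ∑-+ Ks _ _ ⟨
    ∑ Ks (λ c → ⟦ ¬? (c ∈ᴸ? (y ∷ Y)) ⟧ + ⟦ y ≟ c ⟧)         ≤⟨ ∑-mono Ks pointwise ⟩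
    remaining Y                                            ∎
    where
    open ≤-Reasoning
    pointwise : ∀ c → ⟦ ¬? (c ∈ᴸ? (y ∷ Y)) ⟧ + ⟦ y ≟ c ⟧ ≤ ⟦ ¬? (c ∈ᴸ? Y) ⟧
    pointwise c with y ≟ c
    ... | yes refl = ≤-reflexive (trans
            (cong (_+ 1) (⟦⟧-no (¬? (y ∈ᴸ? (y ∷ Y))) (λ ∉ → ∉ (here refl))))
            (sym (⟦⟧-yes (¬? (y ∈ᴸ? Y)) y∉)))
    ... | no _ = ≤-trans (≤-reflexive (+-identityʳ _)) (⟦⟧-mono (¬? (c ∈ᴸ? (y ∷ Y))) (¬? (c ∈ᴸ? Y)) (λ ∉ → ∉ ∘ there))

  module _ (f : R → J) (y₀ : K) where

    -- Passing from f to g moves one unit of load from y₀ to y.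
    Transfer : (R → J) → K → Set
    Transfer g y = ∀ c → load g c + ⟦ y₀ ≟ c ⟧ ≡ load f c + ⟦ y ≟ c ⟧

    -- The second clause lets a transfer to y be prolonged by moving a row that f puts
    -- in y, without following alternating paths.
    Reachable : List K → K → Set
    Reachable Y y = ∃ λ g → Transfer g y × (∀ i → (col i (f i) ≡ y ⊎ col i (f i) ∉ᴸ Y) → g i ≡ f i)

    reachable-weaken : ∀ {Y y} y′ → Reachable Y y → Reachable (y′ ∷ Y) y
    reachable-weaken y′ (g , tr , fix) = g , tr , λ where
      i (inj₁ eq) → fix i (inj₁ eq)
      i (inj₂ ∉) → fix i (inj₂ (∉ ∘ there))

    -- By the first clause of `Reachable`, `g` has left row `i` in its column `col i (f i)`, so the
    -- unit of load that `g` brought there can be passed on by moving row `i` to entry `j`. Rows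
    -- that `f` puts in the new column lie outside `Y`, hence neither `g` nor this move touches
    -- them.
    reachable-step : ∀ {Y} i j → col i (f i) ∈ᴸ Y → col i j ∉ᴸ Y →
      Reachable Y (col i (f i)) → Reachable (col i j ∷ Y) (col i j)
    reachable-step {Y} i j y∈ y′∉ (g , tr , fix) = g′ , tr′ , fix′
      where
      g′ = g [ i ≔ j ]
      -- The balance equations of the two moves are added and the common terms `b + c` cancelled.
      regroup : ∀ a b c d e f → a + b ≡ c + d → c + e ≡ f + b → a + e ≡ f + d
      regroup a b c d e f p q = +-cancelˡ-≡ (b + c) _ _ (begin
        b + c + (a + e)   ≡⟨ shuffle₁ a b c e ⟩
        (a + b) + (c + e) ≡⟨ cong₂ _+_ p q ⟩
        (c + d) + (f + b) ≡⟨ shuffle₂ b c d f ⟩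
        b + c + (f + d)   ∎)
        where
        open ≡-Reasoning
        shuffle₁ : ∀ a b c e → b + c + (a + e) ≡ (a + b) + (c + e)
        shuffle₁ = solve-∀
        shuffle₂ : ∀ b c d f → (c + d) + (f + b) ≡ b + c + (f + d)
        shuffle₂ = solve-∀
      tr′ : Transfer g′ (col i j)
      tr′ c = regroup (load g′ c) ⟦ col i (f i) ≟ c ⟧ (load g c) _ _ (load f c)
        (trans (cong (λ x → load g′ c + ⟦ col i x ≟ c ⟧) (sym (fix i (inj₁ refl)))) (load-≔ g i j c))
        (tr c)
      not-moved : ∀ {k} → col k (f k) ∉ᴸ Y → k ≢ i
      not-moved ∉ refl = ∉ y∈
      fix′ : ∀ k → (col k (f k) ≡ col i j ⊎ col k (f k) ∉ᴸ col i j ∷ Y) → g′ k ≡ f k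
      fix′ k h = trans (≔-other g i j (not-moved (outside-Y h))) (fix k (inj₂ (outside-Y h)))
        where
        outside-Y : (col k (f k) ≡ col i j ⊎ col k (f k) ∉ᴸ col i j ∷ Y) → col k (f k) ∉ᴸ Y
        outside-Y (inj₁ eq) = y′∉ ∘ subst (_∈ᴸ Y) eq
        outside-Y (inj₂ ∉) = ∉ ∘ there

  -- After division by `d`, giving every entry in column `c` the weight `wt c` is a fractional
  -- assignment: each row sums to 1 and column `c` to `cap c`. Both conditions are multiplied out to
  -- stay in `ℕ`.
  module _ (wt cap : K → ℕ) (d : ℕ) (0<d : 0 < d)
           (row-weight : ∀ i → ∑ Js (wt ∘ col i) ≡ d)
           (column-weight : ∀ c → multiplicity c * wt c ≡ d * cap c) where

    instance
      d≢0 : NonZero d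
      d≢0 = >-nonZero 0<d

    -- Double counting the weight of the rows that f sends into Y.
    closed-not-overloaded : ∀ f Y → (∀ i j → col i (f i) ∈ᴸ Y → col i j ∈ᴸ Y) →
      ∑ Ks (λ c → load f c * ⟦ c ∈ᴸ? Y ⟧) ≤ ∑ Ks (λ c → cap c * ⟦ c ∈ᴸ? Y ⟧)
    closed-not-overloaded f Y closed = *-cancelˡ-≤ d (begin
      d * ∑ Ks (λ c → load f c * ⟦ c ∈ᴸ? Y ⟧)                             ≡⟨ cong (d *_) (∑-fibres Rs (λ i → col i (f i)) (λ c → ⟦ c ∈ᴸ? Y ⟧)) ⟨
      d * ∑ Rs (λ i → ⟦ col i (f i) ∈ᴸ? Y ⟧)                              ≡⟨ ∑-*ˡ Rs d _ ⟨
      ∑ Rs (λ i → d * ⟦ col i (f i) ∈ᴸ? Y ⟧)                              ≡⟨ ∑-cong Rs (λ i → cong (_* ⟦ col i (f i) ∈ᴸ? Y ⟧) (row-weight i)) ⟨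
      ∑ Rs (λ i → ∑ Js (wt ∘ col i) * ⟦ col i (f i) ∈ᴸ? Y ⟧)              ≡⟨ ∑-cong Rs (λ i → ∑-*ʳ Js _ _) ⟨
      ∑ Rs (λ i → ∑ Js (λ j → wt (col i j) * ⟦ col i (f i) ∈ᴸ? Y ⟧))      ≤⟨ ∑-mono Rs (λ i → ∑-mono Js (λ j → *-monoʳ-≤ (wt (col i j)) (⟦⟧-mono (col i (f i) ∈ᴸ? Y) (col i j ∈ᴸ? Y) (closed i j)))) ⟩
      ∑ Rs (λ i → ∑ Js (λ j → wt (col i j) * ⟦ col i j ∈ᴸ? Y ⟧))          ≡⟨ ∑-multiplicity (λ c → wt c * ⟦ c ∈ᴸ? Y ⟧) ⟩
      ∑ Ks (λ c → multiplicity c * (wt c * ⟦ c ∈ᴸ? Y ⟧))                  ≡⟨ ∑-cong Ks (λ c → trans (sym (*-assoc (multiplicity c) (wt c) _)) (trans (cong (_* ⟦ c ∈ᴸ? Y ⟧) (column-weight c)) (*-assoc d (cap c) _))) ⟩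
      ∑ Ks (λ c → d * (cap c * ⟦ c ∈ᴸ? Y ⟧))                              ≡⟨ ∑-*ˡ Ks d _ ⟩
      d * ∑ Ks (λ c → cap c * ⟦ c ∈ᴸ? Y ⟧)                                ∎)
      where open ≤-Reasoning

    -- `Y` grows from `y₀` until it contains an underloaded column. If it stops growing first, no
    -- row that `f` puts in `Y` has an entry outside `Y`; then all columns of `Y` are filled and
    -- `y₀` is overfilled, against `closed-not-overloaded`.
    transfer-exists : ∀ f y₀ → cap y₀ < load f y₀ → ∃ λ y → ∃ λ g → load f y < cap y × Transfer f y₀ g y
    transfer-exists f y₀ over = grow _ (y₀ ∷ []) ≤-refl (here refl) start
      where
      start : ∀ y → y ∈ᴸ y₀ ∷ [] → Reachable f y₀ (y₀ ∷ []) y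
      start y (here refl) = f , (λ c → refl) , (λ i _ → refl)
      grow : ∀ fuel Y → remaining Y < fuel → y₀ ∈ᴸ Y → (∀ y → y ∈ᴸ Y → Reachable f y₀ Y y) →
        ∃ λ y → ∃ λ g → load f y < cap y × Transfer f y₀ g y
      grow (suc fuel) Y (s≤s bound) y₀∈ reach
        with find? (λ y → (y ∈ᴸ? Y) ×-dec (load f y <? cap y))
      ... | yes (y , y∈ , under) = y , proj₁ (reach y y∈) , under , proj₁ (proj₂ (reach y y∈))
      ... | no none
        with Finite.find? FR (λ i → (col i (f i) ∈ᴸ? Y) ×-dec Finite.find? FJ (λ j → ¬? (col i j ∈ᴸ? Y)))
      ...   | yes (i , y∈ , j , y′∉) = grow fuel (col i j ∷ Y) (<-≤-trans (remaining-∷ Y (col i j) y′∉) bound) (there y₀∈) λ where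
                y (here refl) → reachable-step f y₀ i j y∈ y′∉ (reach _ y∈)
                y (there y∈Y) → reachable-weaken f y₀ (col i j) (reach y y∈Y)
      ...   | no stuck = contradiction (closed-not-overloaded f Y closed) (<⇒≱ overloaded)
        where
        open ≤-Reasoning
        closed : ∀ i j → col i (f i) ∈ᴸ Y → col i j ∈ᴸ Y
        closed i j y∈ with col i j ∈ᴸ? Y
        ... | yes y′∈ = y′∈
        ... | no y′∉ = contradiction (i , y∈ , j , y′∉) stuck
        pointwise : ∀ c → cap c * ⟦ c ∈ᴸ? Y ⟧ + ⟦ y₀ ≟ c ⟧ ≤ load f c * ⟦ c ∈ᴸ? Y ⟧
        pointwise c with y₀ ≟ c
        ... | yes refl rewrite ⟦⟧-yes (c ∈ᴸ? Y) y₀∈ | *-identityʳ (cap c) | *-identityʳ (load f c) = ≤-trans (≤-reflexive (+-comm (cap c) 1)) over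
        ... | no _ rewrite +-identityʳ (cap c * ⟦ c ∈ᴸ? Y ⟧) with c ∈ᴸ? Y
        ...   | yes c∈ = *-monoˡ-≤ 1 (≮⇒≥ (λ under → none (c , c∈ , under)))
        ...   | no _ = ≤-reflexive (trans (*-zeroʳ (cap c)) (sym (*-zeroʳ (load f c))))
        overloaded : ∑ Ks (λ c → cap c * ⟦ c ∈ᴸ? Y ⟧) < ∑ Ks (λ c → load f c * ⟦ c ∈ᴸ? Y ⟧)
        overloaded = begin
          suc (∑ Ks (λ c → cap c * ⟦ c ∈ᴸ? Y ⟧))                            ≡⟨ +-comm 1 _ ⟩
          ∑ Ks (λ c → cap c * ⟦ c ∈ᴸ? Y ⟧) + 1                              ≡⟨ cong (_ +_) (once y₀) ⟨
          ∑ Ks (λ c → cap c * ⟦ c ∈ᴸ? Y ⟧) + ∑ Ks (λ c → ⟦ y₀ ≟ c ⟧)        ≡⟨ ∑-+ Ks _ _ ⟨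
          ∑ Ks (λ c → cap c * ⟦ c ∈ᴸ? Y ⟧ + ⟦ y₀ ≟ c ⟧)                     ≤⟨ ∑-mono Ks pointwise ⟩
          ∑ Ks (λ c → load f c * ⟦ c ∈ᴸ? Y ⟧)                               ∎

    -- Truncated subtraction ignores underloaded columns, so a transfer from an overloaded to an
    -- underloaded column lowers this measure.
    excess : (R → J) → ℕ
    excess f = ∑ Ks λ c → load f c ∸ cap c

    transfer-excess : ∀ f y₀ y g → cap y₀ < load f y₀ → load f y < cap y → Transfer f y₀ g y → excess g < excess f
    transfer-excess f y₀ y g over under tr = begin
      suc (excess g)                                  ≡⟨ +-comm 1 _ ⟩
      excess g + 1                                    ≡⟨ cong (excess g +_) (once y₀) ⟨
      excess g + ∑ Ks (λ c → ⟦ y₀ ≟ c ⟧)              ≡⟨ ∑-+ Ks _ _ ⟨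
      ∑ Ks (λ c → load g c ∸ cap c + ⟦ y₀ ≟ c ⟧)      ≤⟨ ∑-mono Ks pointwise ⟩
      excess f                                        ∎
      where
      open ≤-Reasoning
      pointwise : ∀ c → load g c ∸ cap c + ⟦ y₀ ≟ c ⟧ ≤ load f c ∸ cap c
      pointwise c with y₀ ≟ c | y ≟ c | tr c
      ... | yes refl | yes refl | _ = contradiction under (<-asym over)
      ... | yes refl | no _ | eq = ≤-reflexive (begin-equality
              load g c ∸ cap c + 1   ≡⟨ +-∸-comm 1 cap≤ ⟨
              load g c + 1 ∸ cap c   ≡⟨ cong (_∸ cap c) eq′ ⟩
              load f c ∸ cap c       ∎)
        where
        eq′ : load g c + 1 ≡ load f c
        eq′ = trans eq (+-identityʳ _)
        cap≤ : cap c ≤ load g c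
        cap≤ = ≤-pred (subst (suc (cap c) ≤_) (trans (sym eq′) (+-comm (load g c) 1)) over)
      ... | no _ | yes refl | eq = ≤-trans (≤-reflexive (trans (+-identityʳ _) (m≤n⇒m∸n≡0 load≤))) z≤n
        where
        load≤ : load g c ≤ cap c
        load≤ = subst (_≤ cap c) (trans (+-comm 1 (load f c)) (trans (sym eq) (+-identityʳ _))) under
      ... | no _ | no _ | eq = ≤-reflexive (trans (+-identityʳ _) (cong (_∸ cap c) (+-cancelʳ-≡ 0 _ _ eq)))

    feasible-choice : (R → J) → ∃ λ f → ∀ c → load f c ≤ cap c
    feasible-choice f₀ = descend _ f₀ ≤-refl
      where
      descend : ∀ fuel f → excess f < fuel → ∃ λ f → ∀ c → load f c ≤ cap c
      descend (suc fuel) f (s≤s bound) with find? (λ c → cap c <? load f c)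
      ... | no none = f , λ c → ≮⇒≥ (λ over → none (c , over))
      ... | yes (y₀ , over) with transfer-exists f y₀ over
      ...   | y , g , under , tr = descend fuel g (<-≤-trans (transfer-excess f y₀ y g over under tr) bound)

    -- The total weight, counted by rows and by columns, shows that the capacities add up to the
    -- number of rows. This is also the total load, so no column can stay below its capacity.
    exact-choice : (R → J) → ∃ λ f → ∀ c → load f c ≡ cap c
    exact-choice f₀ with feasible-choice f₀
    ... | f , le = f , λ c → ∑-≡⇒≡ Ks le total (∈-elems FK c)
      where
      open ≡-Reasoning
      total : ∑ Ks (load f) ≡ ∑ Ks cap
      total = *-cancelˡ-≡ _ _ d (begin
        d * ∑ Ks (load f)                          ≡⟨ cong (d *_) (∑-cong Ks (λ c → *-identityʳ (load f c))) ⟨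
        d * ∑ Ks (λ c → load f c * 1)              ≡⟨ cong (d *_) (∑-fibres Rs (λ i → col i (f i)) (λ _ → 1)) ⟨
        d * ∑ Rs (λ _ → 1)                         ≡⟨ ∑-*ˡ Rs d _ ⟨
        ∑ Rs (λ _ → d * 1)                         ≡⟨ ∑-cong Rs (λ i → trans (*-identityʳ d) (sym (row-weight i))) ⟩
        ∑ Rs (λ i → ∑ Js (wt ∘ col i))             ≡⟨ ∑-multiplicity wt ⟩
        ∑ Ks (λ c → multiplicity c * wt c)         ≡⟨ ∑-cong Ks column-weight ⟩
        ∑ Ks (λ c → d * cap c)                     ≡⟨ ∑-*ˡ Ks d cap ⟩
        d * ∑ Ks cap                               ∎)

-- Counting the completions of a set to a hyperedge.

-- completions r d s = C(d, r − s) (and 0 when s > r) counts the ways to complete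
-- an s-set to an r-set by adding some of d new vertices.
completions : ℕ → ℕ → ℕ → ℕ
completions r zero s = ⟦ s ℕ.≟ r ⟧
completions r (suc d) s = completions r d s + completions r d (suc s)

completions-> : ∀ r d s → r < s → completions r d s ≡ 0
completions-> r zero s r<s = ⟦⟧-no (s ℕ.≟ r) (>⇒≢ r<s)
completions-> r (suc d) s r<s = cong₂ _+_ (completions-> r d s r<s) (completions-> r d (suc s) (m<n⇒m<1+n r<s))

nC0≡1 : ∀ n → n C 0 ≡ 1
nC0≡1 n = trans (nCk≡nC[n∸k] (z≤n {n})) (nCn≡1 n)

-- With `t` for r - s the recursion is Pascal's rule. For `t` zero its second summand would complete
-- a set that is already too large, and vanishes.
completions-C : ∀ r d s t → s + t ≡ r → completions r d s ≡ d C t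
completions-C r zero s zero eq = ⟦⟧-yes (s ℕ.≟ r) (trans (sym (+-identityʳ s)) eq)
completions-C r zero s (suc t) eq = trans
  (⟦⟧-no (s ℕ.≟ r) (<⇒≢ (subst (s <_) eq (m<m+n s (s≤s z≤n)))))
  (sym (k>n⇒nCk≡0 (s≤s (z≤n {t}))))
completions-C r (suc d) s zero eq = begin
  completions r d s + completions r d (suc s)  ≡⟨ cong₂ _+_ (completions-C r d s zero eq) (completions-> r d (suc s) (s≤s (≤-reflexive (trans (sym eq) (+-identityʳ s))))) ⟩
  d C 0 + 0                                    ≡⟨ +-identityʳ (d C 0) ⟩
  d C 0                                        ≡⟨ nC0≡1 d ⟩
  1                                            ≡⟨ nC0≡1 (suc d) ⟨
  suc d C 0                                    ∎
  where open ≡-Reasoning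
completions-C r (suc d) s (suc t) eq = begin
  completions r d s + completions r d (suc s)  ≡⟨ cong₂ _+_ (completions-C r d s (suc t) eq) (completions-C r d (suc s) t (trans (sym (+-suc s t)) eq)) ⟩
  d C suc t + d C t                            ≡⟨ +-comm (d C suc t) (d C t) ⟩
  d C t + d C suc t                            ≡⟨ nCk+nC[k+1]≡[n+1]C[k+1] d t ⟩
  suc d C suc t                                ∎
  where open ≡-Reasoning

-- The absorption identity (r - s) C(d+1, r - s) = (d+1) C(d, r - s - 1), with the term in `s` moved
-- to the right. Both sides without that term count completions with one marked new vertex.
completions-absorb : ∀ r d s →
  r * completions r (suc d) s ≡ s * completions r (suc d) s + suc d * completions r d (suc s)
completions-absorb r zero s = begin
  r * (a + b)                ≡⟨ *-distribˡ-+ r a b ⟩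
  r * a + r * b              ≡⟨ cong₂ _+_ (scale s) (scale (suc s)) ⟩
  s * a + suc s * b          ≡⟨ regroup s a b ⟩
  s * (a + b) + 1 * b        ∎
  where
  open ≡-Reasoning
  a = completions r 0 s
  b = completions r 0 (suc s)
  scale : ∀ s → r * ⟦ s ℕ.≟ r ⟧ ≡ s * ⟦ s ℕ.≟ r ⟧
  scale s = trans (*-comm r _) (trans (⟦⟧*-cong (s ℕ.≟ r) sym) (*-comm _ s))
  regroup : ∀ s a b → s * a + suc s * b ≡ s * (a + b) + 1 * b
  regroup = solve-∀
completions-absorb r (suc d) s = begin
  r * (a + b)                                      ≡⟨ *-distribˡ-+ r a b ⟩
  r * a + r * b                                    ≡⟨ cong₂ _+_ (completions-absorb r d s) (completions-absorb r d (suc s)) ⟩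
  (s * a + suc d * x) + (suc s * b + suc d * y)    ≡⟨ regroup s d a x y ⟩
  s * (a + b) + suc (suc d) * b                    ∎
  where
  open ≡-Reasoning
  x = completions r d (suc s)
  y = completions r d (suc (suc s))
  a = completions r (suc d) s
  b = x + y
  regroup : ∀ s d a x y → (s * a + suc d * x) + (suc s * (x + y) + suc d * y) ≡ s * (a + (x + y)) + suc (suc d) * (x + y)
  regroup = solve-∀

completions-count : ∀ r d s → ∑ (subsets d) (λ T → ⟦ (s + ∣ T ∣) ℕ.≟ r ⟧) ≡ completions r d s
completions-count r zero s rewrite +-identityʳ s = +-identityʳ _
completions-count r (suc d) s = begin
  ∑ (subsets (suc d)) (λ T → ⟦ (s + ∣ T ∣) ℕ.≟ r ⟧)  ≡⟨ ∑-subsets-suc {d} _ ⟩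
  ∑ (subsets d) (λ T → ⟦ (s + suc ∣ T ∣) ℕ.≟ r ⟧) + ∑ (subsets d) (λ T → ⟦ (s + ∣ T ∣) ℕ.≟ r ⟧)
    ≡⟨ cong₂ _+_ (trans (∑-cong (subsets d) (λ T → cong (λ k → ⟦ k ℕ.≟ r ⟧) (+-suc s ∣ T ∣))) (completions-count r d (suc s))) (completions-count r d s) ⟩
  completions r d (suc s) + completions r d s        ≡⟨ +-comm (completions r d (suc s)) _ ⟩
  completions r d s + completions r d (suc s)        ∎
  where open ≡-Reasoning

-- An explicit numbering of the hyperedges.

module _ {r : ℕ} where

  -- Follows the recursion of `completions`, sets without the first vertex coming first, so that as
  -- a colouring it has one colour per hyperedge.
  rank : ∀ {d} s (T : Subset d) → s + ∣ T ∣ ≡ r → Fin (completions r d s)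
  rank s [] eq = subst Fin (sym (⟦⟧-yes (s ℕ.≟ r) (trans (sym (+-identityʳ s)) eq))) zero
  rank s (false ∷ T) eq = rank s T eq ↑ˡ _
  rank s (true ∷ T) eq = _ ↑ʳ rank (suc s) T (trans (sym (+-suc s ∣ T ∣)) eq)

  rank-surjective : ∀ d s (i : Fin (completions r d s)) → ∃ λ T → ∃ λ eq → rank {d} s T eq ≡ i
  rank-surjective zero s i = [] , trans (+-identityʳ s) (inhabited (s ℕ.≟ r) i) , unique (s ℕ.≟ r) _ i
    where
    inhabited : (p? : Dec P) → Fin ⟦ p? ⟧ → P
    inhabited (yes p) _ = p
    unique : (p? : Dec P) (i j : Fin ⟦ p? ⟧) → i ≡ j
    unique (yes _) zero zero = refl
  rank-surjective (suc d) s i with splitAt (completions r d s) i in split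
  ... | inj₁ j with rank-surjective d s j
  ...   | T , eq , refl = false ∷ T , eq , Fin.splitAt⁻¹-↑ˡ split
  rank-surjective (suc d) s i | inj₂ j with rank-surjective d (suc s) j
  ... | T , eq , refl = true ∷ T , trans (+-suc s ∣ T ∣) eq ,
          trans (cong (λ p → completions r d s ↑ʳ rank (suc s) T p) (≡-irrelevant _ eq)) (Fin.splitAt⁻¹-↑ʳ split)

-- Intersections, subsets of given size, and cardinality as a sum.

-- Pigeonhole: unless the first vertex lies in both sets, deleting it lowers the sum of the sizes by
-- at most one, as it does `n`.
subsets-intersect : ∀ {n} (S T : Subset n) → n < ∣ S ∣ + ∣ T ∣ → ∃ λ v → v ∈ S × v ∈ T
subsets-intersect [] [] ()
subsets-intersect (true ∷ S) (true ∷ T) _ = zero , here , here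
subsets-intersect (true ∷ S) (false ∷ T) (s≤s lt) with subsets-intersect S T lt
... | v , v∈S , v∈T = suc v , there v∈S , there v∈T
subsets-intersect {suc n} (false ∷ S) (true ∷ T) lt
  with subsets-intersect S T (≤-pred (subst (suc n <_) (+-suc ∣ S ∣ ∣ T ∣) lt))
... | v , v∈S , v∈T = suc v , there v∈S , there v∈T
subsets-intersect (false ∷ S) (false ∷ T) lt with subsets-intersect S T (<-trans (n<1+n _) lt)
... | v , v∈S , v∈T = suc v , there v∈S , there v∈T

subset-of-size : ∀ {n} (U : Subset n) r → r ≤ ∣ U ∣ → ∃ λ S → ∣ S ∣ ≡ r × (∀ {v} → v ∈ S → v ∈ U)
subset-of-size [] zero _ = [] , refl , λ v∈ → v∈
subset-of-size (false ∷ U) r r≤ with subset-of-size U r r≤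
... | S , eq , S⊆U = false ∷ S , eq , λ { (there v∈) → there (S⊆U v∈) }
subset-of-size (true ∷ U) zero _ with subset-of-size U zero z≤n
... | S , eq , S⊆U = false ∷ S , eq , λ { (there v∈) → there (S⊆U v∈) }
subset-of-size (true ∷ U) (suc r) (s≤s r≤) with subset-of-size U r r≤
... | S , eq , S⊆U = true ∷ S , cong suc eq , λ { here → here ; (there v∈) → there (S⊆U v∈) }

-- Lets incidences between vertices and hyperedges be counted in either order by `∑-swap`.
∣∣-∑ : ∀ {n} (S : Subset n) → ∣ S ∣ ≡ ∑ (allFin n) (λ v → ⟦ v ∈? S ⟧)
∣∣-∑ [] = refl
∣∣-∑ {suc n} (b ∷ S) = begin
  ∣ b ∷ S ∣                                                          ≡⟨ head-count b ⟩
  ⟦ zero ∈? (b ∷ S) ⟧ + ∣ S ∣                                        ≡⟨ cong (⟦ zero ∈? (b ∷ S) ⟧ +_) (∣∣-∑ S) ⟩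
  ⟦ zero ∈? (b ∷ S) ⟧ + ∑ (allFin n) (λ v → ⟦ v ∈? S ⟧)              ≡⟨ cong (⟦ zero ∈? (b ∷ S) ⟧ +_) (∑-cong (allFin n) λ v → ⟦⟧-cong (v ∈? S) (suc v ∈? (b ∷ S)) there drop-there) ⟩
  ⟦ zero ∈? (b ∷ S) ⟧ + ∑ (allFin n) (λ v → ⟦ suc v ∈? (b ∷ S) ⟧)    ≡⟨ ∑-allFin-suc {n} (λ v → ⟦ v ∈? (b ∷ S) ⟧) ⟨
  ∑ (allFin (suc n)) (λ v → ⟦ v ∈? (b ∷ S) ⟧)                        ∎
  where
  open ≡-Reasoning
  head-count : ∀ b → ∣ b ∷ S ∣ ≡ ⟦ zero ∈? (b ∷ S) ⟧ + ∣ S ∣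
  head-count true = refl
  head-count false = refl

nonempty : ∀ {n} (S : Subset n) → 1 ≤ ∣ S ∣ → ∃ λ v → v ∈ S
nonempty {n} S 1≤ with ∑-witness (allFin n) (λ v → ⟦ v ∈? S ⟧) (subst (0 <_) (∣∣-∑ S) 1≤)
... | v , _ , pos = v , ⟦⟧-witness (v ∈? S) pos

-- Lower bounds on the sizes of the classes of a colouring

module Classes {n r m : ℕ} (c : Edge n r → Fin m) where

  -- Formulated for bare subsets, which `subsets n` enumerates. Since any two proofs of `∣ S ∣ ≡ r`
  -- are equal, the colour depends on `S` alone.
  inClass? : ∀ i S → Dec (∃ λ p → c (S , p) ≡ i)
  inClass? i S with ∣ S ∣ ℕ.≟ r
  ... | no ¬p = no (¬p ∘ proj₁)
  ... | yes p = map′ (p ,_) (λ { (p′ , eq) → trans (cong (λ p → c (S , p)) (≡-irrelevant p p′)) eq }) (c (S , p) Fin.≟ i)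

  classSize : Fin m → ℕ
  classSize i = ∑ (subsets n) λ S → ⟦ inClass? i S ⟧

  ∑-classSize : ∑ (allFin m) classSize ≡ completions r n 0
  ∑-classSize = begin
    ∑ (allFin m) classSize                                            ≡⟨ ∑-swap (allFin m) (subsets n) _ ⟩
    ∑ (subsets n) (λ S → ∑ (allFin m) (λ i → ⟦ inClass? i S ⟧))       ≡⟨ ∑-cong (subsets n) classes-of ⟩
    ∑ (subsets n) (λ S → ⟦ ∣ S ∣ ℕ.≟ r ⟧)                             ≡⟨ completions-count r n 0 ⟩
    completions r n 0                                                 ∎
    where
    open ≡-Reasoning
    classes-of : ∀ S → ∑ (allFin m) (λ i → ⟦ inClass? i S ⟧) ≡ ⟦ ∣ S ∣ ℕ.≟ r ⟧
    classes-of S with ∣ S ∣ ℕ.≟ r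
    ... | no ¬p = trans (∑-0 (allFin m)) (sym (⟦⟧-no (∣ S ∣ ℕ.≟ r) ¬p))
    ... | yes p = trans (Finite.once (finiteFin m) (c (S , p))) (sym (⟦⟧-yes (∣ S ∣ ℕ.≟ r) p))

  number-of-classes-≤ : ∀ t → (∀ i → t ≤ classSize i) → m * t ≤ completions r n 0
  number-of-classes-≤ t t≤ = begin
    m * t                        ≡⟨ ∑-allFin-const m t ⟨
    ∑ (allFin m) (λ _ → t)       ≤⟨ ∑-mono (allFin m) t≤ ⟩
    ∑ (allFin m) classSize       ≡⟨ ∑-classSize ⟩
    completions r n 0            ∎
    where open ≤-Reasoning

  class-nonempty : ∀ i → (∃ λ e → c e ≡ i) → 1 ≤ classSize i
  class-nonempty i ((S , p) , eq) = begin
    1                      ≡⟨ ⟦⟧-yes (inClass? i S) (p , eq) ⟨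
    ⟦ inClass? i S ⟧       ≤⟨ ∑-term-≤ (λ S → ⟦ inClass? i S ⟧) (∈-elems (finiteSubset n) S) ⟩
    classSize i            ∎
    where open ≤-Reasoning

  -- The vertices missed by a dominating class contain no hyperedge, so there are fewer than r of them.
  dominating-class-size : 1 ≤ r → ∀ i → IsEdgeDominating n r (λ e → c e ≡ i) → n < r + classSize i * r
  dominating-class-size 1≤r i dom = begin-strict
    n                                                                     ≡⟨ *-identityʳ n ⟨
    n * 1                                                                 ≡⟨ ∑-allFin-const n 1 ⟨
    ∑ (allFin n) (λ _ → 1)                                                ≤⟨ ∑-mono (allFin n) (λ v → missed-or-covered (degree v)) ⟩
    ∑ (allFin n) (λ v → ⟦ degree v ℕ.≟ 0 ⟧ + degree v)                    ≡⟨ ∑-+ (allFin n) _ degree ⟩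
    ∑ (allFin n) (λ v → ⟦ degree v ℕ.≟ 0 ⟧) + ∑ (allFin n) degree         ≡⟨ cong₂ _+_ (sym ∣missed∣) ∑-degree ⟩
    ∣ missed ∣ + classSize i * r                                          <⟨ +-monoˡ-< (classSize i * r) (≰⇒> missed-small) ⟩
    r + classSize i * r                                                   ∎
    where
    open ≤-Reasoning
    degree : Fin n → ℕ
    degree v = ∑ (subsets n) λ S → ⟦ inClass? i S ⟧ * ⟦ v ∈? S ⟧

    -- A vertex is counted through its degree, or once as missed when its degree is zero.
    missed-or-covered : ∀ k → 1 ≤ ⟦ k ℕ.≟ 0 ⟧ + k
    missed-or-covered zero = ≤-refl
    missed-or-covered (suc k) = s≤s z≤n

    ∑-degree : ∑ (allFin n) degree ≡ classSize i * r
    ∑-degree = begin-equality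
      ∑ (allFin n) degree                                                            ≡⟨ ∑-swap (allFin n) (subsets n) _ ⟩
      ∑ (subsets n) (λ S → ∑ (allFin n) (λ v → ⟦ inClass? i S ⟧ * ⟦ v ∈? S ⟧))       ≡⟨ ∑-cong (subsets n) (λ S → trans (∑-*ˡ (allFin n) ⟦ inClass? i S ⟧ _) (cong (⟦ inClass? i S ⟧ *_) (sym (∣∣-∑ S)))) ⟩
      ∑ (subsets n) (λ S → ⟦ inClass? i S ⟧ * ∣ S ∣)                                 ≡⟨ ∑-cong (subsets n) (λ S → ⟦⟧*-cong (inClass? i S) proj₁) ⟩
      ∑ (subsets n) (λ S → ⟦ inClass? i S ⟧ * r)                                     ≡⟨ ∑-*ʳ (subsets n) r _ ⟩
      classSize i * r                                                                ∎

    missed : Subset n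
    missed = Vec.tabulate λ v → does (degree v ℕ.≟ 0)

    ∈missed⇒ : ∀ {v} → v ∈ missed → degree v ≡ 0
    ∈missed⇒ {v} v∈ = does⇒ (degree v ℕ.≟ 0) (trans (sym (Vec.lookup∘tabulate _ v)) (Vec.[]=⇒lookup v∈))

    ⇒∈missed : ∀ {v} → degree v ≡ 0 → v ∈ missed
    ⇒∈missed {v} eq = Vec.lookup⇒[]= v missed (trans (Vec.lookup∘tabulate _ v) (dec-true (degree v ℕ.≟ 0) eq))

    ∣missed∣ : ∣ missed ∣ ≡ ∑ (allFin n) (λ v → ⟦ degree v ℕ.≟ 0 ⟧)
    ∣missed∣ = trans (∣∣-∑ missed) (∑-cong (allFin n) λ v → ⟦⟧-cong (v ∈? missed) (degree v ℕ.≟ 0) ∈missed⇒ ⇒∈missed)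

    -- Domination speaks only of hyperedges outside the class; one inside it meets itself, having a
    -- vertex because `1 ≤ r`.
    touching : ∀ e → ∃ λ f → c f ≡ i × Adjacent e f
    touching e@(S , p) with c e Fin.≟ i
    ... | no ≢i = dom e ≢i
    ... | yes ≡i with nonempty S (subst (1 ≤_) (sym p) 1≤r)
    ...   | v , v∈ = e , ≡i , v , v∈ , v∈

    missed-small : ¬ r ≤ ∣ missed ∣
    missed-small r≤ with subset-of-size missed r r≤
    ... | S , p , S⊆ with touching (S , p)
    ...   | (T , p′) , eq , v , v∈S , v∈T = contradiction (∈missed⇒ (S⊆ v∈S)) (>⇒≢ (begin
              1                                     ≡⟨ cong₂ _*_ (⟦⟧-yes (inClass? i T) (p′ , eq)) (⟦⟧-yes (v ∈? T) v∈T) ⟨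
              ⟦ inClass? i T ⟧ * ⟦ v ∈? T ⟧         ≤⟨ ∑-term-≤ (λ S → ⟦ inClass? i S ⟧ * ⟦ v ∈? S ⟧) (∈-elems (finiteSubset n) T) ⟩
              degree v                              ∎))

-- Baranyai's theorem

-- A partition is encoded as the map from vertices to part indices, so its fibres are automatically
-- disjoint and covering, and may be empty.
part : ∀ {q l} → Vec (Fin q) l → Fin q → Subset l
part [] j = []
part (x ∷ π) j = does (x Fin.≟ j) ∷ part π j

∣does-∷∣ : ∀ {l} (p? : Dec P) (S : Subset l) → ∣ does p? ∷ S ∣ ≡ ⟦ p? ⟧ + ∣ S ∣
∣does-∷∣ (yes _) S = refl
∣does-∷∣ (no _) S = refl

∑-part-size : ∀ {q l} (π : Vec (Fin q) l) → ∑ (allFin q) (λ j → ∣ part π j ∣) ≡ l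
∑-part-size {q} [] = ∑-0 (allFin q)
∑-part-size {q} {suc l} (x ∷ π) = begin
  ∑ (allFin q) (λ j → ∣ part (x ∷ π) j ∣)                                   ≡⟨ ∑-cong (allFin q) (λ j → ∣does-∷∣ (x Fin.≟ j) (part π j)) ⟩
  ∑ (allFin q) (λ j → ⟦ x Fin.≟ j ⟧ + ∣ part π j ∣)                         ≡⟨ ∑-+ (allFin q) _ _ ⟩
  ∑ (allFin q) (λ j → ⟦ x Fin.≟ j ⟧) + ∑ (allFin q) (λ j → ∣ part π j ∣)    ≡⟨ cong₂ _+_ (Finite.once (finiteFin q) x) (∑-part-size π) ⟩
  suc l                                                                     ∎
  where open ≡-Reasoning

∈-part : ∀ {q l} (π : Vec (Fin q) l) v → v ∈ part π (Vec.lookup π v)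
∈-part (x ∷ π) zero = subst (λ b → (b ∷ part π x) [ zero ]= inside) (sym (dec-true (x Fin.≟ x) refl)) here
∈-part (x ∷ π) (suc v) = there (∈-part π v)

module Baranyai (q r M : ℕ) where

  occurrences : ∀ {l} → (Fin M → Vec (Fin q) l) → Subset l → ℕ
  occurrences π S = ∑ (allFin M) λ i → ∑ (allFin q) λ j → ⟦ part (π i) j ≟ˢ S ⟧

  -- M partitions of the first l vertices into q parts, in which every S is a part as many
  -- times as there are hyperedges meeting the first l vertices exactly in S.
  Family : ℕ → ℕ → Set
  Family l d = ∃ λ (π : Fin M → Vec (Fin q) l) → ∀ S → occurrences π S ≡ completions r d ∣ S ∣

  part-occurs : ∀ {l} (π : Fin M → Vec (Fin q) l) i j → 1 ≤ occurrences π (part (π i) j)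
  part-occurs π i j = begin
    1                                                           ≡⟨ ⟦⟧-yes (part (π i) j ≟ˢ part (π i) j) refl ⟨
    ⟦ part (π i) j ≟ˢ part (π i) j ⟧                            ≤⟨ ∑-term-≤ (λ k → ⟦ part (π i) k ≟ˢ part (π i) j ⟧) (∈-elems (finiteFin q) j) ⟩
    ∑ (allFin q) (λ k → ⟦ part (π i) k ≟ˢ part (π i) j ⟧)       ≤⟨ ∑-term-≤ (λ h → ∑ (allFin q) (λ k → ⟦ part (π h) k ≟ˢ part (π i) j ⟧)) (∈-elems (finiteFin M) i) ⟩
    occurrences π (part (π i) j)                                ∎
    where open ≤-Reasoning

  -- With no vertex inserted, all `M * q` parts are the empty set, which every hyperedge completes.
  initial : ∀ n → M * q ≡ completions r n 0 → Family 0 n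
  initial n eq = (λ _ → []) , λ { [] → trans (trans (∑-cong (allFin M) (λ _ → ∑-allFin-const q 1)) (trans (∑-allFin-const M (q * 1)) (cong (M *_) (*-identityʳ q)))) eq }

  -- The rows for the rounding are the `M` partitions, the entries of a row its parts, and `f i` is
  -- the part of partition `i` that receives the new vertex. The capacity of `S` is the number of
  -- times that `S` with the new vertex has to occur.
  extend : ∀ {l d} → Fin q → l + suc d ≡ q * r → Family l (suc d) → Family (suc l) d
  extend {l} {d} j₀ l+d (π , count) = π′ , count′
    where
    open Rounding (finiteFin M) (finiteFin q) (finiteSubset l) (λ i → part (π i))

    -- A part with more than `r` vertices has no completion but does occur. The bound makes
    -- `r ∸ ∣ part (π i) j ∣` a true difference in `row-weight`.
    part-size-≤ : ∀ i j → ∣ part (π i) j ∣ ≤ r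
    part-size-≤ i j = ≮⇒≥ λ r< → contradiction
      (trans (count (part (π i) j)) (completions-> r (suc d) _ r<))
      (>⇒≢ (part-occurs π i j))

    row-weight : ∀ i → ∑ (allFin q) (λ j → r ∸ ∣ part (π i) j ∣) ≡ suc d
    row-weight i = +-cancelʳ-≡ l _ _ (begin
      ∑ (allFin q) (λ j → r ∸ ∣ part (π i) j ∣) + l                                              ≡⟨ cong (∑ (allFin q) (λ j → r ∸ ∣ part (π i) j ∣) +_) (∑-part-size (π i)) ⟨
      ∑ (allFin q) (λ j → r ∸ ∣ part (π i) j ∣) + ∑ (allFin q) (λ j → ∣ part (π i) j ∣)          ≡⟨ ∑-+ (allFin q) _ _ ⟨
      ∑ (allFin q) (λ j → r ∸ ∣ part (π i) j ∣ + ∣ part (π i) j ∣)                               ≡⟨ ∑-cong (allFin q) (λ j → m∸n+n≡m (part-size-≤ i j)) ⟩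
      ∑ (allFin q) (λ _ → r)                                                                     ≡⟨ ∑-allFin-const q r ⟩
      q * r                                                                                      ≡⟨ l+d ⟨
      l + suc d                                                                                  ≡⟨ +-comm l (suc d) ⟩
      suc d + l                                                                                  ∎)
      where open ≡-Reasoning

    -- The absorption identity, with its term in `s` subtracted again.
    column-weight : ∀ S → occurrences π S * (r ∸ ∣ S ∣) ≡ suc d * completions r d (suc ∣ S ∣)
    column-weight S = begin
      occurrences π S * (r ∸ s)                             ≡⟨ cong (_* (r ∸ s)) (count S) ⟩
      completions r (suc d) s * (r ∸ s)                     ≡⟨ *-comm (completions r (suc d) s) (r ∸ s) ⟩
      (r ∸ s) * completions r (suc d) s                     ≡⟨ *-distribʳ-∸ (completions r (suc d) s) r s ⟩
      r * completions r (suc d) s ∸ s * completions r (suc d) s    ≡⟨ cong (_∸ s * completions r (suc d) s) (completions-absorb r d s) ⟩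
      s * completions r (suc d) s + suc d * completions r d (suc s) ∸ s * completions r (suc d) s    ≡⟨ m+n∸m≡n (s * completions r (suc d) s) _ ⟩
      suc d * completions r d (suc s)                       ∎
      where
      open ≡-Reasoning
      s = ∣ S ∣

    choice = exact-choice (λ S → r ∸ ∣ S ∣) (λ S → completions r d (suc ∣ S ∣)) (suc d) (s≤s z≤n) row-weight column-weight (λ _ → j₀)
    f = proj₁ choice

    π′ : Fin M → Vec (Fin q) (suc l)
    π′ i = f i ∷ π i

    -- Only part `f i` of partition `i` contains the new vertex, so this count is the load of `S`
    -- under `f`.
    count-inside : ∀ S → occurrences π′ (inside ∷ S) ≡ completions r d (suc ∣ S ∣)
    count-inside S = trans (∑-cong (allFin M) λ i → trans
        (∑-cong (allFin q) (λ j → product (f i Fin.≟ j) (part (π i) j)))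
        (Finite.∑-sift (finiteFin q) (f i) (λ j → ⟦ part (π i) j ≟ˢ S ⟧)))
      (proj₂ choice S)
      where
      product : (p? : Dec P) (T : Subset l) → ⟦ (does p? ∷ T) ≟ˢ (inside ∷ S) ⟧ ≡ ⟦ p? ⟧ * ⟦ T ≟ˢ S ⟧
      product (yes _) T = trans (⟦⟧-cong ((inside ∷ T) ≟ˢ (inside ∷ S)) (T ≟ˢ S) (λ { refl → refl }) (cong (inside ∷_))) (sym (*-identityˡ _))
      product (no _) T = refl

    count-either : ∀ S → occurrences π′ (outside ∷ S) + occurrences π′ (inside ∷ S) ≡ occurrences π S
    count-either S = trans (sym (∑-+ (allFin M) _ _)) (∑-cong (allFin M) λ i →
      trans (sym (∑-+ (allFin q) _ _)) (∑-cong (allFin q) λ j → either (does (f i Fin.≟ j)) (part (π i) j)))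
      where
      either : ∀ b (T : Subset l) → ⟦ (b ∷ T) ≟ˢ (outside ∷ S) ⟧ + ⟦ (b ∷ T) ≟ˢ (inside ∷ S) ⟧ ≡ ⟦ T ≟ˢ S ⟧
      either true T = ⟦⟧-cong ((inside ∷ T) ≟ˢ (inside ∷ S)) (T ≟ˢ S) (λ { refl → refl }) (cong (inside ∷_))
      either false T = trans (+-identityʳ _) (⟦⟧-cong ((outside ∷ T) ≟ˢ (outside ∷ S)) (T ≟ˢ S) (λ { refl → refl }) (cong (outside ∷_)))

    count′ : ∀ S → occurrences π′ S ≡ completions r d ∣ S ∣
    count′ (true ∷ S) = count-inside S
    -- The count of `S` before the insertion splits over its two extensions exactly as
    -- `completions r (suc d) ∣ S ∣` unfolds, so one count determines the other.
    count′ (false ∷ S) = +-cancelʳ-≡ (completions r d (suc ∣ S ∣)) _ _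
      (trans (cong (occurrences π′ (outside ∷ S) +_) (sym (count-inside S))) (trans (count-either S) (count S)))

  family : Fin q → M * q ≡ completions r (q * r) 0 → ∀ l d → l + d ≡ q * r → Family l d
  family j₀ eq zero d refl = initial d eq
  family j₀ eq (suc l) d l+d = extend j₀ l+d′ (family j₀ eq l (suc d) l+d′)
    where
    l+d′ = trans (+-suc l d) l+d

  -- With no vertex left to insert, `completions r 0` is the indicator of size `r`: all parts are
  -- hyperedges and each hyperedge is a part exactly once. Its colour is the partition it occurs in.
  parallel-classes⇒partition : ∀ {n} → Fin q → 1 ≤ r → Family n 0 → HasEdgeDomaticPartition n r M
  parallel-classes⇒partition {n} j₀ 1≤r (π , count) = colour , surjective , dominating
    where
    locate : ∀ S → ∣ S ∣ ≡ r → ∃ λ i → ∃ λ j → part (π i) j ≡ S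
    locate S p with ∑-witness (allFin M) _ (≤-reflexive (sym (trans (count S) (⟦⟧-yes (∣ S ∣ ℕ.≟ r) p))))
    ... | i , _ , posᵢ with ∑-witness (allFin q) _ posᵢ
    ...   | j , _ , posⱼ = i , j , ⟦⟧-witness (part (π i) j ≟ˢ S) posⱼ

    colour : Edge n r → Fin M
    colour (S , p) = proj₁ (locate S p)

    edge : Fin M → Fin q → Edge n r
    edge i j = part (π i) j , ⟦⟧-witness (∣ part (π i) j ∣ ℕ.≟ r) (subst (1 ≤_) (count (part (π i) j)) (part-occurs π i j))

    part-unique : ∀ {i i′ j j′} → part (π i) j ≡ part (π i′) j′ → i ≡ i′
    part-unique {i} {i′} {j} {j′} eq with i Fin.≟ i′
    ... | yes i≡i′ = i≡i′
    ... | no i≢i′ = contradiction (begin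
        2                              ≤⟨ +-mono-≤ (row i j refl) (row i′ j′ (sym eq)) ⟩
        inRow i + inRow i′             ≤⟨ Finite.∑-two-terms-≤ (finiteFin M) inRow i≢i′ ⟩
        occurrences π S                ≡⟨ count S ⟩
        ⟦ ∣ S ∣ ℕ.≟ r ⟧                ≡⟨ ⟦⟧-yes (∣ S ∣ ℕ.≟ r) (proj₂ (edge i j)) ⟩
        1                              ∎) (<⇒≱ (s≤s (s≤s z≤n)))
      where
      open ≤-Reasoning
      S = part (π i) j
      inRow : Fin M → ℕ
      inRow h = ∑ (allFin q) λ k → ⟦ part (π h) k ≟ˢ S ⟧
      row : ∀ h k → part (π h) k ≡ S → 1 ≤ inRow h
      row h k eq = ≤-trans (≤-reflexive (sym (⟦⟧-yes (part (π h) k ≟ˢ S) eq))) (∑-term-≤ (λ k → ⟦ part (π h) k ≟ˢ S ⟧) (∈-elems (finiteFin q) k))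

    colour-edge : ∀ i j → colour (edge i j) ≡ i
    colour-edge i j = part-unique (proj₂ (proj₂ (locate (part (π i) j) (proj₂ (edge i j)))))

    surjective : ∀ i → ∃ λ e → colour e ≡ i
    surjective i = edge i j₀ , colour-edge i j₀

    dominating : ∀ i → IsEdgeDominating n r (λ e → colour e ≡ i)
    -- Partition `i` covers every vertex, so its part through any `v` in `S` is the required
    -- neighbour.
    dominating i (S , p) _ with nonempty S (subst (1 ≤_) (sym p) 1≤r)
    ... | v , v∈S = edge i j , colour-edge i j , v , v∈S , ∈-part (π i) v
      where
      j = Vec.lookup (π i) v

-- The two cases of the theorem.

n/2<r⇒n<r+r : ∀ n r → n / 2 < r → n < r + r
n/2<r⇒n<r+r n r lt = ≰⇒> λ r+r≤n → contradiction (begin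
  r              ≡⟨ m*n/n≡m r 2 ⟨
  r * 2 / 2      ≡⟨ cong (_/ 2) (trans (*-comm r 2) (cong (r +_) (+-identityʳ r))) ⟩
  (r + r) / 2    ≤⟨ /-monoˡ-≤ 2 r+r≤n ⟩
  n / 2          ∎) (<⇒≱ lt)
  where open ≤-Reasoning

intersecting-case : ∀ n r → n / 2 < r → IsEdgeDomaticNumber n r (completions r n 0)
intersecting-case n r lt = ((λ (S , p) → rank 0 S p) , surjective , dominating) , maximal
  where
  surjective : ∀ i → ∃ λ (e : Edge n r) → rank 0 (proj₁ e) (proj₂ e) ≡ i
  surjective i with rank-surjective n 0 i
  ... | S , p , eq = (S , p) , eq
  dominating : ∀ i → IsEdgeDominating n r (λ (S , p) → rank 0 S p ≡ i)
  dominating i (S , p) _ with surjective i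
  ... | (T , p′) , eq = (T , p′) , eq , subsets-intersect S T (subst (n <_) (cong₂ _+_ (sym p) (sym p′)) (n/2<r⇒n<r+r n r lt))
  maximal : ∀ m → HasEdgeDomaticPartition n r m → m ≤ completions r n 0
  maximal m (c , surj , _) = ≤-trans (≤-reflexive (sym (*-identityʳ m))) (number-of-classes-≤ 1 (λ i → class-nonempty i (surj i)))
    where open Classes c

divisible-case : ∀ n r → 1 ≤ r → r ≤ n → ∀ q → n ≡ q * r →
  ∃ λ k → IsEdgeDomaticNumber n r k × k * q ≡ completions r n 0
divisible-case _ r 1≤r r≤n zero refl = contradiction r≤n (<⇒≱ 1≤r)
divisible-case _ r@(suc r-1) 1≤r r≤n q@(suc _) refl = M , (exists , maximal) , M*q
  where
  -- Both factors are successors, so `q * r` is definitionally `suc n-1`, the form that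
  -- `completions-absorb` takes.
  n-1 : ℕ
  n-1 = pred (q * r)
  -- The number of hyperedges through a fixed vertex: each perfect matching contains exactly one of
  -- them. This gives the quotient without a division.
  M : ℕ
  M = completions r n-1 1
  M*q : M * q ≡ completions r (q * r) 0
  M*q = *-cancelˡ-≡ _ _ r (begin
    r * (M * q)                      ≡⟨ regroup r M q ⟩
    q * r * M                        ≡⟨ completions-absorb r n-1 0 ⟨
    r * completions r (q * r) 0      ∎)
    where
    open ≡-Reasoning
    regroup : ∀ r M q → r * (M * q) ≡ q * r * M
    regroup = solve-∀
  open Baranyai q r M
  exists : HasEdgeDomaticPartition (q * r) r M
  exists = parallel-classes⇒partition zero 1≤r (family zero M*q (q * r) 0 (+-identityʳ (q * r)))
  maximal : ∀ m → HasEdgeDomaticPartition (q * r) r m → m ≤ M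
  maximal m (c , _ , dom) = *-cancelʳ-≤ m M q (≤-trans (number-of-classes-≤ q q≤) (≤-reflexive (sym M*q)))
    where
    open Classes c
    q≤ : ∀ i → q ≤ classSize i
    -- Here `q * r < suc (classSize i) * r`; cancelling `r` leaves a strict bound on `q`, which is
    -- the bound wanted.
    q≤ i = ≤-pred (*-cancelʳ-< r q (suc (classSize i)) (dominating-class-size 1≤r i (dom i)))

theorem4 : (n r : ℕ) → 1 ≤ r → r ≤ n →
    ((n / 2 < r) → IsEdgeDomaticNumber n r (n C r)) ×
    ((r ≤ n / 2) → (q : ℕ) → n ≡ q * r →
      ∃ λ k → IsEdgeDomaticNumber n r k × k * q ≡ n C r)
theorem4 n r 1≤r r≤n =
  (λ lt → subst (IsEdgeDomaticNumber n r) edges (intersecting-case n r lt)) ,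
  (λ _ q eq → let k , num , k*q = divisible-case n r 1≤r r≤n q eq in k , num , trans k*q edges)
  where
  edges : completions r n 0 ≡ n C r
  edges = completions-C r n 0 r refl
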